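{- For every nonnegative integer $n$, $$\sum_{k=0}^{\infty}(-1)^k(4k+1)\,\frac{(-3n)_k\,(-2n+\tfrac16)_k\,(\tfrac12)_k}{k!\,(2n+\tfrac43)_k\,(3n+\tfrac32)_k}=\left(\frac{2^2 3^3}{5^5}\right)^n\frac{(\tfrac56)_n(\tfrac12)_n(\tfrac76)_n^2}{(\tfrac{7}{15})_n(\tfrac{13}{15})_n(\tfrac{16}{15})_n(\tfrac{4}{15})_n}.$$ (The sum is finite, since $(-3n)_k=0$ for $k>3n$.)
   Context: $(a)_j=\Gamma(a+j)/\Gamma(a)=a(a+1)\cdots(a+j-1)$ denotes the rising factorial (Pochhammer symbol), with $(a)_0=1$. -}

module Defs where

open import Data.Nat.Base as ℕ using (ℕ; zero; suc; _!)
import Data.Nat.Properties as ℕ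
open import Data.Integer.Base using (+_)
open import Data.Rational.Base
open import Data.Rational.Properties
open import Algebra.Definitions.RawSemiring +-*-rawSemiring using (_^_)

fromℕ : ℕ → ℚ
fromℕ n = + n / 1

-- The rising factorial (a)ⱼ = a (a + 1) ⋯ (a + j − 1), with (a)₀ = 1.
poch : ℚ → ℕ → ℚ
poch a zero    = 1ℚ
poch a (suc j) = poch a j * (a + fromℕ j)

fromℕ-nonNeg : ∀ n → NonNegative (fromℕ n)
fromℕ-nonNeg n = normalize-nonNeg n 1

fromℕ+-pos : ∀ n q → .{{Positive q}} → Positive (fromℕ n + q)
fromℕ+-pos n q = nonNeg+pos⇒pos (fromℕ n) {{fromℕ-nonNeg n}} q

poch-pos : ∀ a j → .{{Positive a}} → Positive (poch a j)
poch-pos a zero    = _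
poch-pos a (suc j) =
  pos*pos⇒pos (poch a j) {{poch-pos a j}} (a + fromℕ j)
    {{pos+nonNeg⇒pos a (fromℕ j) {{fromℕ-nonNeg j}}}}

factorial-pos : ∀ k → Positive (fromℕ (k !))
factorial-pos k = normalize-pos (k !) 1 {{_}} {{k ℕ.!≢0}}

summandDenominator : ℕ → ℕ → ℚ
summandDenominator n k =
  fromℕ (k !) * poch (fromℕ (2 ℕ.* n) + + 4 / 3) k * poch (fromℕ (3 ℕ.* n) + + 3 / 2) k

summandDenominator-pos : ∀ n k → Positive (summandDenominator n k)
summandDenominator-pos n k =
  pos*pos⇒pos (fromℕ (k !) * p) {{pos*pos⇒pos (fromℕ (k !)) {{factorial-pos k}} p {{p>0}}}} q {{q>0}}
  where
  a = fromℕ (2 ℕ.* n) + + 4 / 3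
  b = fromℕ (3 ℕ.* n) + + 3 / 2
  p = poch a k
  q = poch b k
  p>0 : Positive p
  p>0 = poch-pos a k {{fromℕ+-pos (2 ℕ.* n) (+ 4 / 3)}}
  q>0 : Positive q
  q>0 = poch-pos b k {{fromℕ+-pos (3 ℕ.* n) (+ 3 / 2)}}

-- For k > 3n the factor poch (- fromℕ (3 ℕ.* n)) k is 0, so the partial sums of
-- ∑ₖ summand n k are constant from k = 3n on; the value of the infinite series is
-- that of any partial sum up to some N ≥ 3n.
summand : ℕ → ℕ → ℚ
summand n k =
  ((- 1ℚ) ^ k * fromℕ (4 ℕ.* k ℕ.+ 1)
    * (poch (- fromℕ (3 ℕ.* n)) k * poch (- fromℕ (2 ℕ.* n) + + 1 / 6) k * poch (+ 1 / 2) k))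
  ÷ summandDenominator n k
  where
  instance
    denominator≢0 : NonZero (summandDenominator n k)
    denominator≢0 = pos⇒nonZero (summandDenominator n k) {{summandDenominator-pos n k}}

closedFormDenominator : ℕ → ℚ
closedFormDenominator n =
  poch (+ 7 / 15) n * poch (+ 13 / 15) n * poch (+ 16 / 15) n * poch (+ 4 / 15) n

closedFormDenominator-pos : ∀ n → Positive (closedFormDenominator n)
closedFormDenominator-pos n =
  pos*pos⇒pos (p * q * r)
    {{pos*pos⇒pos (p * q)
      {{pos*pos⇒pos p {{poch-pos (+ 7 / 15) n}} q {{poch-pos (+ 13 / 15) n}}}}
      r {{poch-pos (+ 16 / 15) n}}}}
    s {{poch-pos (+ 4 / 15) n}}
  where
  p = poch (+ 7 / 15) n
  q = poch (+ 13 / 15) n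
  r = poch (+ 16 / 15) n
  s = poch (+ 4 / 15) n

closedForm : ℕ → ℚ
closedForm n =
  (+ (2 ℕ.^ 2 ℕ.* 3 ℕ.^ 3) / 5 ℕ.^ 5) ^ n
    * ((poch (+ 5 / 6) n * poch (+ 1 / 2) n * poch (+ 7 / 6) n ^ 2) ÷ closedFormDenominator n)
  where
  instance
    denominator≢0 : NonZero (closedFormDenominator n)
    denominator≢0 = pos⇒nonZero (closedFormDenominator n) {{closedFormDenominator-pos n}}

{-# OPTIONS --safe #-}
-- The left-hand side is a very-well-poised ₄F₃(−1).  With m in place of 3n and with a free
-- parameter d, its sum is (3/2)ₘ / (d)ₘ (here d = 2n + 4/3): the sums for m and m + 1 satisfy
-- a first-order recurrence in m, because the defect of that recurrence on partial sums up to K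
-- has a closed form (a Wilf–Zeilberger certificate) that vanishes for K > m.  The right-hand side
-- then comes from (4/3)₅ₙ = (4/3)₂ₙ (2n + 4/3)₃ₙ and the multiplication formula for (pb)ₚₙ with
-- p = 2, 3, 5; the factor (2/3)ₙ common to p = 2 and p = 5 cancels.

module Submission where

open import Defs
open import Data.Nat.Base using (ℕ; _*_; _≤_)
open import Data.Fin.Base using (toℕ)
open import Data.Rational.Properties using (+-0-monoid)
open import Algebra.Properties.Monoid.Sum +-0-monoid using (sum⁺-syntax)
open import Relation.Binary.PropositionalEquality using (_≡_)
open import Algebra.Bundles using (CommutativeRing)
open import Algebra.Definitions.RawSemiring Data.Rational.Properties.+-*-rawSemiring using (_^_)
open import Algebra.Properties.CommutativeSemiring.Exp
  (CommutativeRing.commutativeSemiring Data.Rational.Properties.+-*-commutativeRing)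
  using (^-distrib-*)
open import Algebra.Properties.Monoid.Sum +-0-monoid using (sum-init-last; sum-cong-≗)
import Data.Fin.Properties as Fin
import Data.Integer.Base as ℤ
import Data.Integer.Properties as ℤ
open import Data.Integer.Base using (+_)
open import Data.Nat.Base as ℕ using (zero; suc; _!)
import Data.Nat.Properties as ℕ
open import Data.Rational.Base as ℚ
  using (ℚ; 0ℚ; 1ℚ; ½; _+_; _-_; -_; 1/_; _÷_; Positive; NonZero; toℚᵘ; _/_)
  renaming (_*_ to _·_)
import Data.Rational.Properties as ℚ
open import Data.Rational.Solver using (module +-*-Solver)
open import Data.Rational.Unnormalised.Base as ℚᵘ using (mkℚᵘ; *≡*)
import Data.Rational.Unnormalised.Properties as ℚᵘ
open import Data.Sum.Base using (inj₁; inj₂)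
open import Relation.Binary.PropositionalEquality
  using (refl; sym; trans; cong; cong₂; module ≡-Reasoning)
open +-*-Solver
open ≡-Reasoning

-- Arithmetic of embedded naturals, reciprocals and finite sums.

toℚᵘ-fromℕ : ∀ n → toℚᵘ (fromℕ n) ℚᵘ.≃ mkℚᵘ (+ n) 0
toℚᵘ-fromℕ n = ℚ.toℚᵘ-fromℚᵘ (mkℚᵘ (+ n) 0)

-- The quotient n / 1 is normalised by a gcd that does not compute for a variable n. On unnormalised
-- rationals the equation becomes one between integers.
fromℕ-+ : ∀ m n → fromℕ (m ℕ.+ n) ≡ fromℕ m + fromℕ n
fromℕ-+ m n = ℚ.toℚᵘ-injective
  (ℚᵘ.≃-trans (toℚᵘ-fromℕ (m ℕ.+ n))
  (ℚᵘ.≃-trans (*≡* (cong (λ i → i ℤ.* + 1) (sym (cong₂ ℤ._+_ (ℤ.*-identityʳ (+ m)) (ℤ.*-identityʳ (+ n))))))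
  (ℚᵘ.≃-sym (ℚᵘ.≃-trans (ℚ.toℚᵘ-homo-+ (fromℕ m) (fromℕ n))
    (ℚᵘ.+-cong (toℚᵘ-fromℕ m) (toℚᵘ-fromℕ n))))))

fromℕ-* : ∀ m n → fromℕ (m * n) ≡ fromℕ m · fromℕ n
fromℕ-* m n = ℚ.toℚᵘ-injective
  (ℚᵘ.≃-trans (toℚᵘ-fromℕ (m * n))
  (ℚᵘ.≃-trans (*≡* (cong (λ i → i ℤ.* + 1) (ℤ.pos-* m n)))
  (ℚᵘ.≃-sym (ℚᵘ.≃-trans (ℚ.toℚᵘ-homo-* (fromℕ m) (fromℕ n))
    (ℚᵘ.*-cong (toℚᵘ-fromℕ m) (toℚᵘ-fromℕ n))))))

fromℕ-suc : ∀ n → fromℕ (suc n) ≡ 1ℚ + fromℕ n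
fromℕ-suc = fromℕ-+ 1

recip : ∀ q → .{{Positive q}} → ℚ
recip q = (1/ q) {{ℚ.pos⇒nonZero q}}

*-recipʳ : ∀ q .{{_ : Positive q}} → q · recip q ≡ 1ℚ
*-recipʳ q = ℚ.*-inverseʳ q {{ℚ.pos⇒nonZero q}}

÷-*-cancel : ∀ p q .{{_ : NonZero q}} → (p ÷ q) · q ≡ p
÷-*-cancel p q = trans (ℚ.*-assoc p (1/ q) q) (trans (cong (p ·_) (ℚ.*-inverseˡ q)) (ℚ.*-identityʳ p))

-- Serves to clear denominators: two quotients are compared after multiplication by a positive
-- common denominator.
*-cancelʳ-pos : ∀ r .{{_ : Positive r}} {p q} → p · r ≡ q · r → p ≡ q
*-cancelʳ-pos r eq = ℚ.≤-antisym
  (ℚ.*-cancelʳ-≤-pos r (ℚ.≤-reflexive eq)) (ℚ.*-cancelʳ-≤-pos r (ℚ.≤-reflexive (sym eq)))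

-- Serves induction on the upper limit, where the new term comes last, whereas sums over `Fin`
-- unfold at the front.
∑-last : ∀ (f : ℕ → ℚ) K → ∑[ k ≤ suc K ] f (toℕ k) ≡ ∑[ k ≤ K ] f (toℕ k) + f (suc K)
∑-last f K = trans (sum-init-last (λ k → f (toℕ k))) (cong₂ _+_
  (sum-cong-≗ {suc K} (λ k → cong f (Fin.toℕ-inject₁ k))) (cong f (Fin.toℕ-fromℕ (suc K))))

-- The factor of the summand that depends on m.

halfShift : ℕ → ℚ
halfShift j = fromℕ j + + 3 / 2

recipHalf : ℕ → ℚ
recipHalf j = recip (halfShift j) {{fromℕ+-pos j (+ 3 / 2)}}

halfShift-recip : ∀ j → halfShift j · recipHalf j ≡ 1ℚ
halfShift-recip j = *-recipʳ (halfShift j) {{fromℕ+-pos j (+ 3 / 2)}}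

-- (−1)ᵏ (−m)ₖ / (m + 3/2)ₖ.
altRatio : ℕ → ℕ → ℚ
altRatio m zero    = 1ℚ
altRatio m (suc k) = altRatio m k · ((fromℕ m - fromℕ k) · recipHalf (m ℕ.+ k))

-- In each step the new sign turns -m + k into m - k, and the reciprocal cancels the new factor m +
-- k + 3/2.
altRatio-poch : ∀ m k →
  altRatio m k · poch (halfShift m) k ≡ (- 1ℚ) ^ k · poch (- fromℕ m) k
altRatio-poch m zero    = refl
altRatio-poch m (suc k) = begin
  a · ((M - K) · r) · (P · (M + + 3 / 2 + K))
    ≡⟨ solve 5 (λ a P M K r → a :* ((M :- K) :* r) :* (P :* (M :+ con (+ 3 / 2) :+ K))
         := a :* P :* (M :- K) :* ((M :+ K :+ con (+ 3 / 2)) :* r)) refl a P M K r ⟩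
  a · P · (M - K) · ((M + K + + 3 / 2) · r)
    ≡⟨ cong₂ _·_ (cong (_· (M - K)) (altRatio-poch m k))
         (trans (cong (λ x → (x + + 3 / 2) · r) (sym (fromℕ-+ m k))) (halfShift-recip (m ℕ.+ k))) ⟩
  s · Q · (M - K) · 1ℚ
    ≡⟨ solve 4 (λ s Q M K → s :* Q :* (M :- K) :* con 1ℚ := (con (- 1ℚ) :* s) :* (Q :* (:- M :+ K))) refl s Q M K ⟩
  (- 1ℚ · s) · (Q · (- M + K)) ∎
  where
  a = altRatio m k
  P = poch (halfShift m) k
  Q = poch (- fromℕ m) k
  s = (- 1ℚ) ^ k
  M = fromℕ m
  K = fromℕ k
  r = recipHalf (m ℕ.+ k)

-- The factor m - m enters on passing from index m to m + 1, and all later values are multiples of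
-- that zero.
altRatio-vanishes : ∀ {m k} → m ℕ.< k → altRatio m k ≡ 0ℚ
altRatio-vanishes {m} {suc k} (ℕ.s≤s m≤k) with ℕ.m≤n⇒m<n∨m≡n m≤k
... | inj₁ m<k  = trans (cong (_· ((fromℕ m - fromℕ k) · recipHalf (m ℕ.+ k))) (altRatio-vanishes m<k))
  (ℚ.*-zeroˡ ((fromℕ m - fromℕ k) · recipHalf (m ℕ.+ k)))
... | inj₂ refl = solve 3 (λ a M r → a :* ((M :- M) :* r) := con 0ℚ) refl (altRatio m m) (fromℕ m) (recipHalf (m ℕ.+ m))

-- Combines (-m-1)ₖ₊₁ = -(m+1) (-m)ₖ with (m+3/2) (m+5/2)ₖ₊₁ = (m+3/2)ₖ (m+k+3/2) (m+k+5/2). It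
-- gives the terms for m and m + 1 the common factor `altRatio m k`.
altRatio-sucˡ : ∀ m k → altRatio (suc m) (suc k) ≡
  altRatio m k · (fromℕ (suc m) · halfShift m) · (recipHalf (m ℕ.+ k) · recipHalf (suc (m ℕ.+ k)))
altRatio-sucˡ m zero = begin
  1ℚ · ((M₁ - 0ℚ) · r′)
    ≡⟨ solve 2 (λ M r → con 1ℚ :* ((M :- con 0ℚ) :* r) := M :* r :* con 1ℚ) refl M₁ r′ ⟩
  M₁ · r′ · 1ℚ
    ≡⟨ cong (M₁ · r′ ·_) (trans (cong (λ j → h · recipHalf j) (ℕ.+-identityʳ m)) (halfShift-recip m)) ⟨
  M₁ · r′ · (h · r)
    ≡⟨ solve 4 (λ M r′ h r → M :* r′ :* (h :* r) := con 1ℚ :* (M :* h) :* (r :* r′)) refl M₁ r′ h r ⟩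
  1ℚ · (M₁ · h) · (r · r′) ∎
  where
  M₁ = fromℕ (suc m)
  h = halfShift m
  r = recipHalf (m ℕ.+ 0)
  r′ = recipHalf (suc (m ℕ.+ 0))
altRatio-sucˡ m (suc k) = begin
  altRatio (suc m) (suc k) · ((M₁ - fromℕ (suc k)) · recipHalf (suc m ℕ.+ suc k))
    ≡⟨ cong (λ j → altRatio (suc m) (suc k) · ((M₁ - fromℕ (suc k)) · recipHalf (suc j))) (ℕ.+-suc m k) ⟩
  altRatio (suc m) (suc k) · ((M₁ - fromℕ (suc k)) · r″)
    ≡⟨ cong₂ (λ x y → x · (y · r″)) (altRatio-sucˡ m k) (cong₂ _-_ (fromℕ-suc m) (fromℕ-suc k)) ⟩
  a · (M₁ · h) · (r · r′) · (((1ℚ + M) - (1ℚ + K)) · r″)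
    ≡⟨ solve 8 (λ a M₁ h r r′ r″ M K →
         a :* (M₁ :* h) :* (r :* r′) :* (((con 1ℚ :+ M) :- (con 1ℚ :+ K)) :* r″)
         := (a :* ((M :- K) :* r)) :* (M₁ :* h) :* (r′ :* r″)) refl a M₁ h r r′ r″ M K ⟩
  (a · ((M - K) · r)) · (M₁ · h) · (r′ · r″)
    ≡⟨ cong (λ j → (a · ((M - K) · r)) · (M₁ · h) · (recipHalf j · r″)) (ℕ.+-suc m k) ⟨
  (a · ((M - K) · r)) · (M₁ · h) · (recipHalf (m ℕ.+ suc k) · r″)
    ≡⟨ cong (λ j → (a · ((M - K) · r)) · (M₁ · h) · (recipHalf (m ℕ.+ suc k) · recipHalf (suc j))) (ℕ.+-suc m k) ⟨
  (a · ((M - K) · r)) · (M₁ · h) · (recipHalf (m ℕ.+ suc k) · recipHalf (suc (m ℕ.+ suc k))) ∎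
  where
  a = altRatio m k
  M = fromℕ m
  K = fromℕ k
  M₁ = fromℕ (suc m)
  h = halfShift m
  r = recipHalf (m ℕ.+ k)
  r′ = recipHalf (suc (m ℕ.+ k))
  r″ = recipHalf (suc (suc (m ℕ.+ k)))

-- The very-well-poised sum with a free parameter `d`.

fromℕ-4k+1 : ∀ k → fromℕ (4 * k ℕ.+ 1) ≡ fromℕ 4 · fromℕ k + 1ℚ
fromℕ-4k+1 k = trans (fromℕ-+ (4 * k) 1) (cong (_+ 1ℚ) (fromℕ-* 4 k))

fromℕ-suc-pos : ∀ k → Positive (fromℕ (suc k))
fromℕ-suc-pos k = ℚ.normalize-pos (suc k) 1

module Sum (d : ℚ) .{{d>0 : Positive d}} where

  d+k-pos : ∀ k → Positive (d + fromℕ k)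
  d+k-pos k = ℚ.pos+nonNeg⇒pos d (fromℕ k) {{fromℕ-nonNeg k}}

  -- The well-poised partner of `d`: with a = 1/2, the pairs (c, d), (-m, m + 3/2) and (1/2, 1) all
  -- add up to 1 + a = 3/2. The factor 4k + 1 is (a + 2k) / a.
  c : ℚ
  c = + 3 / 2 - d

  -- (c)ₖ (1/2)ₖ / (k! (d)ₖ).
  weight : ℕ → ℚ
  weight zero    = 1ℚ
  weight (suc k) = weight k · ((c + fromℕ k) · (½ + fromℕ k)
    · (recip (fromℕ (suc k)) {{fromℕ-suc-pos k}} · recip (d + fromℕ k) {{d+k-pos k}}))

  weight-suc : ∀ k → weight (suc k) · (fromℕ (suc k) · (d + fromℕ k))
                   ≡ weight k · ((c + fromℕ k) · (½ + fromℕ k))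
  weight-suc k = begin
    w · (x · (r · s)) · (y · z)
      ≡⟨ solve 6 (λ w x r s y z → w :* (x :* (r :* s)) :* (y :* z) := w :* x :* (y :* r) :* (z :* s)) refl w x r s y z ⟩
    w · x · (y · r) · (z · s)
      ≡⟨ cong₂ (λ p q → w · x · p · q) (*-recipʳ y {{fromℕ-suc-pos k}}) (*-recipʳ z {{d+k-pos k}}) ⟩
    w · x · 1ℚ · 1ℚ
      ≡⟨ trans (ℚ.*-identityʳ (w · x · 1ℚ)) (ℚ.*-identityʳ (w · x)) ⟩
    w · x ∎
    where
    w = weight k
    x = (c + fromℕ k) · (½ + fromℕ k)
    y = fromℕ (suc k)
    z = d + fromℕ k
    r = recip y {{fromℕ-suc-pos k}}
    s = recip z {{d+k-pos k}}

  weight-poch : ∀ k → weight k · (fromℕ (k !) · poch d k) ≡ poch c k · poch ½ k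
  weight-poch zero    = refl
  weight-poch (suc k) = begin
    w′ · (fromℕ (suc k * k !) · (D · (d + K)))
      ≡⟨ cong (λ x → w′ · (x · (D · (d + K)))) (fromℕ-* (suc k) (k !)) ⟩
    w′ · (K₁ · f · (D · (d + K)))
      ≡⟨ solve 5 (λ w′ K₁ f D z → w′ :* (K₁ :* f :* (D :* z)) := w′ :* (K₁ :* z) :* (f :* D)) refl w′ K₁ f D (d + K) ⟩
    w′ · (K₁ · (d + K)) · (f · D)
      ≡⟨ cong (_· (f · D)) (weight-suc k) ⟩
    w · ((c + K) · (½ + K)) · (f · D)
      ≡⟨ solve 4 (λ w x y z → w :* (x :* y) :* z := w :* z :* (x :* y)) refl w (c + K) (½ + K) (f · D) ⟩
    w · (f · D) · ((c + K) · (½ + K))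
      ≡⟨ cong (_· ((c + K) · (½ + K))) (weight-poch k) ⟩
    poch c k · poch ½ k · ((c + K) · (½ + K))
      ≡⟨ solve 4 (λ a b x y → a :* b :* (x :* y) := a :* x :* (b :* y)) refl (poch c k) (poch ½ k) (c + K) (½ + K) ⟩
    poch c k · (c + K) · (poch ½ k · (½ + K)) ∎
    where
    w = weight k
    w′ = weight (suc k)
    K = fromℕ k
    K₁ = fromℕ (suc k)
    f = fromℕ (k !)
    D = poch d k

  term : ℕ → ℕ → ℚ
  term m k = altRatio m k · (fromℕ (4 * k ℕ.+ 1) · weight k)

  partial : ℕ → ℕ → ℚ
  partial m K = ∑[ k ≤ K ] term m (toℕ k)

  -- A rational multiple of the k-th term without its factor 4k + 1. The product (c + k)(1/2 + k) is
  -- the numerator of the ratio of consecutive weights, so the value at k can also be written with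
  -- `weight (suc k)`.
  certificate : ℕ → ℕ → ℚ
  certificate m k = - fromℕ 2 · halfShift m · ((c + fromℕ k) · (½ + fromℕ k))
    · (altRatio m k · weight k · recipHalf (m ℕ.+ k))

  -- Telescoping by induction on K: (d + m) times the term for m + 1, minus (m + 3/2) times the term
  -- for m, is the increment of the certificate.
  partial-recurrence : ∀ m K →
    (d + fromℕ m) · partial (suc m) K - halfShift m · partial m K ≡ certificate m K
  partial-recurrence m zero = begin
    (d + M) · one - h · one
      -- Both sums are 1 here, and d + m - (m + 3/2) = -c = -2 · c · 1/2.
      ≡⟨ solve 2 (λ d M → (d :+ M) :* con 1ℚ :- (M :+ con (+ 3 / 2)) :* con 1ℚ
           := :- con (fromℕ 2) :* con 1ℚ :* ((con (+ 3 / 2) :- d :+ con 0ℚ) :* con ½)) refl d M ⟩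
    - fromℕ 2 · 1ℚ · ((c + 0ℚ) · ½)
      ≡⟨ cong (λ x → - fromℕ 2 · x · ((c + 0ℚ) · ½))
           (trans (cong (λ j → h · recipHalf j) (ℕ.+-identityʳ m)) (halfShift-recip m)) ⟨
    - fromℕ 2 · (h · r) · ((c + 0ℚ) · ½)
      ≡⟨ solve 3 (λ h r c → :- con (fromℕ 2) :* (h :* r) :* ((c :+ con 0ℚ) :* con ½)
           := :- con (fromℕ 2) :* h :* ((c :+ con 0ℚ) :* con ½) :* (con 1ℚ :* r)) refl h r c ⟩
    - fromℕ 2 · h · ((c + 0ℚ) · ½) · (1ℚ · r) ∎
    where
    one = 1ℚ
    M = fromℕ m
    h = halfShift m
    r = recipHalf (m ℕ.+ 0)
  partial-recurrence m (suc k) = begin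
    (d + M) · partial (suc m) (suc k) - h · partial m (suc k)
      ≡⟨ cong₂ (λ x y → (d + M) · x - h · y) (∑-last (term (suc m)) k) (∑-last (term m) k) ⟩
    (d + M) · (S′ + term (suc m) (suc k)) - h · (S + term m (suc k))
      ≡⟨ solve 6 (λ a h S′ t′ S t → a :* (S′ :+ t′) :- h :* (S :+ t) := (a :* S′ :- h :* S) :+ (a :* t′ :- h :* t))
           refl (d + M) h S′ (term (suc m) (suc k)) S (term m (suc k)) ⟩
    ((d + M) · S′ - h · S) + ((d + M) · term (suc m) (suc k) - h · term m (suc k))
      ≡⟨ cong₂ _+_ (partial-recurrence m k)
           (cong₂ (λ x y → (d + M) · (x · y) - h · (u · ((M - K) · r) · y)) u′-eq
             (cong (_· w′) F-eq)) ⟩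
    - fromℕ 2 · h · ((c + K) · (½ + K)) · (u · w · r)
      + ((d + M) · (u · ((1ℚ + M) · h) · (r · r′) · (F · w′)) - h · (u · ((M - K) · r) · (F · w′)))
      ≡⟨ cong (_+ ((d + M) · (u · ((1ℚ + M) · h) · (r · r′) · (F · w′)) - h · (u · ((M - K) · r) · (F · w′))))
           certificate-eq ⟩
    - fromℕ 2 · h · (u · r) · (w′ · ((1ℚ + K) · (d + K)))
      + ((d + M) · (u · ((1ℚ + M) · h) · (r · r′) · (F · w′)) - h · (u · ((M - K) · r) · (F · w′)))
      -- Two of the three products lack `r′`. They receive a factor 1, which then becomes (m + k +
      -- 5/2) `r′`. After that every product contains u r r′ w′, and what remains is a polynomial
      -- identity.
      ≡⟨ pad ⟩
    - fromℕ 2 · h · (u · r) · (w′ · ((1ℚ + K) · (d + K))) · 1ℚ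
      + ((d + M) · (u · ((1ℚ + M) · h) · (r · r′) · (F · w′)) - h · (u · ((M - K) · r) · (F · w′)) · 1ℚ)
      ≡⟨ cong (λ x → - fromℕ 2 · h · (u · r) · (w′ · ((1ℚ + K) · (d + K))) · x
           + ((d + M) · (u · ((1ℚ + M) · h) · (r · r′) · (F · w′)) - h · (u · ((M - K) · r) · (F · w′)) · x)) unit ⟨
    - fromℕ 2 · h · (u · r) · (w′ · ((1ℚ + K) · (d + K))) · ((1ℚ + (M + K) + + 3 / 2) · r′)
      + ((d + M) · (u · ((1ℚ + M) · h) · (r · r′) · (F · w′))
         - h · (u · ((M - K) · r) · (F · w′)) · ((1ℚ + (M + K) + + 3 / 2) · r′))
      ≡⟨ solve 7 (λ u r r′ w′ M K d →
           let h = M :+ con (+ 3 / 2)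
               F = con (fromℕ 4) :* (con 1ℚ :+ K) :+ con 1ℚ
               B = (con 1ℚ :+ (M :+ K) :+ con (+ 3 / 2)) :* r′
           in :- con (fromℕ 2) :* h :* (u :* r) :* (w′ :* ((con 1ℚ :+ K) :* (d :+ K))) :* B
                :+ ((d :+ M) :* (u :* ((con 1ℚ :+ M) :* h) :* (r :* r′) :* (F :* w′))
                    :- h :* (u :* ((M :- K) :* r) :* (F :* w′)) :* B)
              := :- con (fromℕ 2) :* h :* ((con (+ 3 / 2) :- d :+ (con 1ℚ :+ K)) :* (con ½ :+ (con 1ℚ :+ K)))
                   :* (u :* ((M :- K) :* r) :* w′ :* r′)) refl u r r′ w′ M K d ⟩
    - fromℕ 2 · h · ((c + (1ℚ + K)) · (½ + (1ℚ + K))) · (u · ((M - K) · r) · w′ · r′)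
      ≡⟨ cong₂ (λ x j → - fromℕ 2 · h · ((c + x) · (½ + x)) · (u · ((M - K) · r) · w′ · recipHalf j))
           (fromℕ-suc k) (ℕ.+-suc m k) ⟨
    certificate m (suc k) ∎
    where
    M = fromℕ m
    K = fromℕ k
    h = halfShift m
    u = altRatio m k
    w = weight k
    w′ = weight (suc k)
    r = recipHalf (m ℕ.+ k)
    r′ = recipHalf (suc (m ℕ.+ k))
    S = partial m k
    S′ = partial (suc m) k
    F = fromℕ 4 · (1ℚ + K) + 1ℚ
    F-eq : fromℕ (4 * suc k ℕ.+ 1) ≡ F
    F-eq = trans (fromℕ-4k+1 (suc k)) (cong (λ x → fromℕ 4 · x + 1ℚ) (fromℕ-suc k))
    u′-eq : altRatio (suc m) (suc k) ≡ u · ((1ℚ + M) · h) · (r · r′)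
    u′-eq = trans (altRatio-sucˡ m k) (cong (λ x → u · (x · h) · (r · r′)) (fromℕ-suc m))
    unit : (1ℚ + (M + K) + + 3 / 2) · r′ ≡ 1ℚ
    unit = trans (cong (λ x → (x + + 3 / 2) · r′)
                   (sym (trans (fromℕ-suc (m ℕ.+ k)) (cong (λ x → 1ℚ + x) (fromℕ-+ m k)))))
                 (halfShift-recip (suc (m ℕ.+ k)))
    -- Trades `weight k` for `weight (suc k)`, the weight occurring in the new terms.
    certificate-eq : - fromℕ 2 · h · ((c + K) · (½ + K)) · (u · w · r)
                   ≡ - fromℕ 2 · h · (u · r) · (w′ · ((1ℚ + K) · (d + K)))
    certificate-eq = begin
      - fromℕ 2 · h · ((c + K) · (½ + K)) · (u · w · r)
        ≡⟨ solve 5 (λ h x u w r → :- con (fromℕ 2) :* h :* x :* (u :* w :* r)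
             := :- con (fromℕ 2) :* h :* (u :* r) :* (w :* x)) refl h ((c + K) · (½ + K)) u w r ⟩
      - fromℕ 2 · h · (u · r) · (w · ((c + K) · (½ + K)))
        ≡⟨ cong (- fromℕ 2 · h · (u · r) ·_)
             (trans (sym (weight-suc k)) (cong (λ x → w′ · (x · (d + K))) (fromℕ-suc k))) ⟩
      - fromℕ 2 · h · (u · r) · (w′ · ((1ℚ + K) · (d + K))) ∎
    pad : - fromℕ 2 · h · (u · r) · (w′ · ((1ℚ + K) · (d + K)))
            + ((d + M) · (u · ((1ℚ + M) · h) · (r · r′) · (F · w′)) - h · (u · ((M - K) · r) · (F · w′)))
        ≡ - fromℕ 2 · h · (u · r) · (w′ · ((1ℚ + K) · (d + K))) · 1ℚ
            + ((d + M) · (u · ((1ℚ + M) · h) · (r · r′) · (F · w′)) - h · (u · ((M - K) · r) · (F · w′)) · 1ℚ)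
    pad = solve 3 (λ x y z → x :+ (y :- z) := x :* con 1ℚ :+ (y :- z :* con 1ℚ)) refl
      (- fromℕ 2 · h · (u · r) · (w′ · ((1ℚ + K) · (d + K))))
      ((d + M) · (u · ((1ℚ + M) · h) · (r · r′) · (F · w′)))
      (h · (u · ((M - K) · r) · (F · w′)))

  partial-zero : ∀ K → partial 0 K ≡ 1ℚ
  partial-zero zero    = refl
  partial-zero (suc k) = begin
    partial 0 (suc k)
      ≡⟨ ∑-last (term 0) k ⟩
    partial 0 k + altRatio 0 (suc k) · v
      ≡⟨ cong₂ (λ x y → x + y · v) (partial-zero k) (altRatio-vanishes {0} {suc k} (ℕ.s≤s ℕ.z≤n)) ⟩
    1ℚ + 0ℚ · v
      ≡⟨ solve 1 (λ v → con 1ℚ :+ con 0ℚ :* v := con 1ℚ) refl v ⟩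
    1ℚ ∎
    where v = fromℕ (4 * suc k ℕ.+ 1) · weight (suc k)

  certificate-vanishes : ∀ {m k} → m ℕ.< k → certificate m k ≡ 0ℚ
  certificate-vanishes {m} {k} m<k = begin
    x · (altRatio m k · w · r)  ≡⟨ cong (λ u → x · (u · w · r)) (altRatio-vanishes m<k) ⟩
    x · (0ℚ · w · r)            ≡⟨ solve 3 (λ x w r → x :* (con 0ℚ :* w :* r) := con 0ℚ) refl x w r ⟩
    0ℚ ∎
    where
    x = - fromℕ 2 · halfShift m · ((c + fromℕ k) · (½ + fromℕ k))
    w = weight k
    r = recipHalf (m ℕ.+ k)

  -- Induction on m with K fixed. From m + 1 ≤ K the certificate vanishes at K, so the recurrence
  -- becomes homogeneous: each step multiplies the sum by (m + 3/2) / (d + m).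
  partial-closed : ∀ m {K} → m ≤ K → partial m K · poch d m ≡ poch (+ 3 / 2) m
  partial-closed zero    {K} _   = trans (ℚ.*-identityʳ (partial 0 K)) (partial-zero K)
  partial-closed (suc m) {K} m<K = begin
    S′ · (P · (d + M))
      ≡⟨ solve 5 (λ S′ S P a h → S′ :* (P :* a) := ((a :* S′ :- h :* S) :+ h :* S) :* P) refl S′ S P (d + M) h ⟩
    (((d + M) · S′ - h · S) + h · S) · P
      ≡⟨ cong (λ x → (x + h · S) · P) (trans (partial-recurrence m K) (certificate-vanishes m<K)) ⟩
    (0ℚ + h · S) · P
      ≡⟨ solve 3 (λ S P M → (con 0ℚ :+ (M :+ con (+ 3 / 2)) :* S) :* P := S :* P :* (con (+ 3 / 2) :+ M)) refl S P M ⟩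
    S · P · (+ 3 / 2 + M)
      ≡⟨ cong (_· (+ 3 / 2 + M)) (partial-closed m (ℕ.<⇒≤ m<K)) ⟩
    poch (+ 3 / 2) m · (+ 3 / 2 + M) ∎
    where
    M = fromℕ m
    P = poch d m
    S = partial m K
    S′ = partial (suc m) K
    h = halfShift m

-- Addition and multiplication formulas for rising factorials.

poch-+ : ∀ a m k → poch a (m ℕ.+ k) ≡ poch a m · poch (a + fromℕ m) k
poch-+ a m zero    = trans (cong (poch a) (ℕ.+-identityʳ m)) (sym (ℚ.*-identityʳ (poch a m)))
poch-+ a m (suc k) = begin
  poch a (m ℕ.+ suc k)
    ≡⟨ cong (poch a) (ℕ.+-suc m k) ⟩
  poch a (m ℕ.+ k) · (a + fromℕ (m ℕ.+ k))
    ≡⟨ cong₂ (λ x y → x · (a + y)) (poch-+ a m k) (fromℕ-+ m k) ⟩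
  P · Q · (a + (M + K))
    ≡⟨ solve 5 (λ P Q a M K → P :* Q :* (a :+ (M :+ K)) := P :* (Q :* (a :+ M :+ K))) refl P Q a M K ⟩
  P · (Q · (a + M + K)) ∎
  where
  P = poch a m
  Q = poch (a + fromℕ m) k
  M = fromℕ m
  K = fromℕ k

-- ∏_{i<j} (b + i s)ₙ; with p s = 1 and j = p these are the factors of (p b)ₚₙ.
∏poch : ℚ → ℚ → ℕ → ℕ → ℚ
∏poch b s zero    n = 1ℚ
∏poch b s (suc j) n = ∏poch b s j n · poch (b + fromℕ j · s) n

∏poch-zero : ∀ b s j → ∏poch b s j 0 ≡ 1ℚ
∏poch-zero b s zero    = refl
∏poch-zero b s (suc j) = trans (ℚ.*-identityʳ (∏poch b s j 0)) (∏poch-zero b s j)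

-- Passing to n + 1 gives the i-th factor the new term b + i s + n, and p times it is p (b + n) + i
-- because p s = 1. Keeping the number `j` of factors apart from `p` allows induction on `j`.
∏poch-suc : ∀ p b s j n → p · s ≡ 1ℚ →
  p ^ j · ∏poch b s j (suc n) ≡ poch (p · (b + fromℕ n)) j · ∏poch b s j n
∏poch-suc p b s zero    n ps≡1 = refl
∏poch-suc p b s (suc j) n ps≡1 = begin
  p · t · (Q′ · (x · (b + J · s + N)))
    ≡⟨ solve 8 (λ p t Q′ x b J s N → p :* t :* (Q′ :* (x :* (b :+ J :* s :+ N)))
         := t :* Q′ :* x :* (p :* (b :+ N) :+ J :* (p :* s))) refl p t Q′ x b J s N ⟩
  t · Q′ · x · (p · (b + N) + J · (p · s))
    ≡⟨ cong₂ (λ y z → y · x · (p · (b + N) + J · z)) (∏poch-suc p b s j n ps≡1) ps≡1 ⟩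
  P · Q · x · (p · (b + N) + J · 1ℚ)
    ≡⟨ solve 5 (λ P Q x y J → P :* Q :* x :* (y :+ J :* con 1ℚ) := P :* (y :+ J) :* (Q :* x)) refl P Q x (p · (b + N)) J ⟩
  P · (p · (b + N) + J) · (Q · x) ∎
  where
  t = p ^ j
  J = fromℕ j
  N = fromℕ n
  x = poch (b + J · s) n
  Q = ∏poch b s j n
  Q′ = ∏poch b s j (suc n)
  P = poch (p · (b + N)) j

-- Induction on n: the p factors added to (p b)ₚₙ start at p b + p n = p (b + n). With 1/p supplied
-- as `s`, the condition p s = 1 holds by computation for a concrete p.
poch-multiplication : ∀ p b s n → fromℕ p · s ≡ 1ℚ →
  poch (fromℕ p · b) (p * n) ≡ (fromℕ p ^ p) ^ n · ∏poch b s p n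
poch-multiplication p b s zero ps≡1 = begin
  poch (fromℕ p · b) (p * 0)  ≡⟨ cong (poch (fromℕ p · b)) (ℕ.*-zeroʳ p) ⟩
  1ℚ                          ≡⟨ trans (ℚ.*-identityˡ (∏poch b s p 0)) (∏poch-zero b s p) ⟨
  1ℚ · ∏poch b s p 0          ∎
poch-multiplication p b s (suc n) ps≡1 = begin
  poch a (p * suc n)
    ≡⟨ cong (poch a) (trans (ℕ.*-suc p n) (ℕ.+-comm p (p * n))) ⟩
  poch a (p * n ℕ.+ p)
    ≡⟨ poch-+ a (p * n) p ⟩
  poch a (p * n) · poch (a + fromℕ (p * n)) p
    ≡⟨ cong₂ (λ x y → x · poch y p) (poch-multiplication p b s n ps≡1) shift ⟩
  t · Q · poch (q · (b + N)) p
    ≡⟨ solve 3 (λ t Q P → t :* Q :* P := t :* (P :* Q)) refl t Q (poch (q · (b + N)) p) ⟩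
  t · (poch (q · (b + N)) p · Q)
    ≡⟨ cong (t ·_) (∏poch-suc q b s p n ps≡1) ⟨
  t · (q ^ p · Q′)
    ≡⟨ solve 3 (λ t x Q′ → t :* (x :* Q′) := x :* t :* Q′) refl t (q ^ p) Q′ ⟩
  q ^ p · t · Q′ ∎
  where
  q = fromℕ p
  a = q · b
  N = fromℕ n
  t = (q ^ p) ^ n
  Q = ∏poch b s p n
  Q′ = ∏poch b s p (suc n)
  shift : a + fromℕ (p * n) ≡ q · (b + N)
  shift = trans (cong (λ x → a + x) (fromℕ-* p n)) (sym (ℚ.*-distribˡ-+ q b N))

-- Specialisation to m = 3n and `d` = 2n + 4/3.

^-pos : ∀ q n .{{_ : Positive q}} → Positive (q ^ n)
^-pos q zero    = _
^-pos q (suc n) = ℚ.pos*pos⇒pos q (q ^ n) {{^-pos q n}}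

module _ (n : ℕ) where

  d : ℚ
  d = fromℕ (2 * n) + + 4 / 3

  d-pos : Positive d
  d-pos = fromℕ+-pos (2 * n) (+ 4 / 3)

  open Sum d {{d-pos}} using (term; partial; partial-closed; weight; weight-poch; c)

  c-eq : c ≡ - fromℕ (2 * n) + + 1 / 6
  c-eq = solve 1 (λ x → con (+ 3 / 2) :- (x :+ con (+ 4 / 3)) := :- x :+ con (+ 1 / 6)) refl (fromℕ (2 * n))

  -- After clearing the denominator, `altRatio` accounts for the pair (-3n)ₖ, (3n + 3/2)ₖ and the
  -- sign, and `weight` for the other four rising factorials.
  summand≡term : ∀ k → summand n k ≡ term (3 * n) k
  summand≡term k = *-cancelʳ-pos (summandDenominator n k) {{summandDenominator-pos n k}} (begin
    summand n k · summandDenominator n k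
      ≡⟨ ÷-*-cancel (s · F · (Q · C · H)) (summandDenominator n k)
           {{ℚ.pos⇒nonZero (summandDenominator n k) {{summandDenominator-pos n k}}}} ⟩
    s · F · (Q · C · H)
      ≡⟨ cong (λ x → s · F · (Q · poch x k · H)) c-eq ⟨
    s · F · (Q · poch c k · H)
      ≡⟨ solve 5 (λ s F Q C H → s :* F :* (Q :* C :* H) := s :* Q :* F :* (C :* H)) refl s F Q (poch c k) H ⟩
    s · Q · F · (poch c k · H)
      ≡⟨ cong₂ (λ x y → x · F · y) (altRatio-poch (3 * n) k) (weight-poch k) ⟨
    u · P · F · (w · (f · D))
      ≡⟨ solve 6 (λ u P F w f D → u :* P :* F :* (w :* (f :* D)) := u :* (F :* w) :* (f :* D :* P)) refl u P F w f D ⟩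
    u · (F · w) · (f · D · P) ∎)
    where
    s = (- 1ℚ) ^ k
    F = fromℕ (4 * k ℕ.+ 1)
    Q = poch (- fromℕ (3 * n)) k
    C = poch (- fromℕ (2 * n) + + 1 / 6) k
    H = poch ½ k
    u = altRatio (3 * n) k
    w = weight k
    f = fromℕ (k !)
    D = poch d k
    P = poch (halfShift (3 * n)) k

  partial≡closedForm : ∀ {K} → 3 * n ≤ K → partial (3 * n) K ≡ closedForm n
  -- The multiplier `Z` consists of the powers of 5⁵, the denominator of the closed form, and the
  -- factor (2/3)ₙ that both sides share.
  partial≡closedForm {K} 3n≤K = *-cancelʳ-pos Z {{Z-pos}} (begin
    S · (γ · (D · T))
      -- Starting at 4/15 with step 1/5 gives 4/15, 7/15, 10/15 = 2/3, 13/15, 16/15.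
      ≡⟨ solve 7 (λ S γ T p₇ p₁₃ p₁₆ p₄ → S :* (γ :* (p₇ :* p₁₃ :* p₁₆ :* p₄ :* T))
           := S :* (γ :* (con 1ℚ :* p₄ :* p₇ :* T :* p₁₃ :* p₁₆))) refl S γ T p₇ p₁₃ p₁₆ p₄ ⟩
    S · (γ · ∏poch (+ 4 / 15) (+ 1 / 5) 5 n)
      ≡⟨ cong (S ·_) (poch-multiplication 5 (+ 4 / 15) (+ 1 / 5) n refl) ⟨
    S · poch (+ 4 / 3) (5 * n)
      ≡⟨ cong (S ·_) split ⟩
    S · (poch (+ 4 / 3) (2 * n) · poch d (3 * n))
      ≡⟨ solve 3 (λ S x y → S :* (x :* y) := x :* (S :* y)) refl S (poch (+ 4 / 3) (2 * n)) (poch d (3 * n)) ⟩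
    poch (+ 4 / 3) (2 * n) · (S · poch d (3 * n))
      ≡⟨ cong (poch (+ 4 / 3) (2 * n) ·_) (partial-closed (3 * n) 3n≤K) ⟩
    poch (+ 4 / 3) (2 * n) · poch (+ 3 / 2) (3 * n)
      -- Here p = 2 gives 2/3 and 7/6, and p = 3 gives 1/2, 5/6 and 7/6; hence the square of (7/6)ₙ.
      ≡⟨ cong₂ _·_ (poch-multiplication 2 (+ 2 / 3) ½ n refl) (poch-multiplication 3 ½ (+ 1 / 3) n refl) ⟩
    α · (1ℚ · T · V) · (β · (1ℚ · H · E · V))
      ≡⟨ solve 6 (λ α β T V H E → α :* (con 1ℚ :* T :* V) :* (β :* (con 1ℚ :* H :* E :* V))
           := α :* β :* (E :* H :* (V :* (V :* con 1ℚ))) :* T) refl α β T V H E ⟩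
    α · β · N · T
      -- Both 4 · 27 and (108/3125) · 3125 compute to 108, so the two product rules for powers meet.
      ≡⟨ cong (λ x → x · N · T) (trans (sym (^-distrib-* (fromℕ 4) (fromℕ 27) n)) (^-distrib-* ρ₁ (fromℕ 3125) n)) ⟩
    ρ · γ · N · T
      ≡⟨ cong (λ x → ρ · γ · x · T) (÷-*-cancel N D {{D≢0}}) ⟨
    ρ · γ · (R · D) · T
      ≡⟨ solve 5 (λ ρ γ R D T → ρ :* γ :* (R :* D) :* T := ρ :* R :* (γ :* (D :* T))) refl ρ γ R D T ⟩
    ρ · R · (γ · (D · T)) ∎)
    where
    S = partial (3 * n) K
    ρ₁ = + (2 ℕ.^ 2 * 3 ℕ.^ 3) / 5 ℕ.^ 5
    ρ = ρ₁ ^ n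
    α = fromℕ 4 ^ n
    β = fromℕ 27 ^ n
    γ = fromℕ 3125 ^ n
    p₄ = poch (+ 4 / 15) n
    p₇ = poch (+ 7 / 15) n
    p₁₃ = poch (+ 13 / 15) n
    p₁₆ = poch (+ 16 / 15) n
    T = poch (+ 2 / 3) n
    V = poch (+ 7 / 6) n
    H = poch ½ n
    E = poch (+ 5 / 6) n
    D = closedFormDenominator n
    N = E · H · V ^ 2
    D≢0 : NonZero D
    D≢0 = ℚ.pos⇒nonZero D {{closedFormDenominator-pos n}}
    R = (N ÷ D) {{D≢0}}
    Z = γ · (D · T)
    Z-pos : Positive Z
    Z-pos = ℚ.pos*pos⇒pos γ {{^-pos (fromℕ 3125) n}} (D · T)
      {{ℚ.pos*pos⇒pos D {{closedFormDenominator-pos n}} T {{poch-pos (+ 2 / 3) n}}}}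
    split : poch (+ 4 / 3) (5 * n) ≡ poch (+ 4 / 3) (2 * n) · poch d (3 * n)
    split = begin
      poch (+ 4 / 3) (5 * n)
        ≡⟨ cong (poch (+ 4 / 3)) (ℕ.*-distribʳ-+ n 2 3) ⟩
      poch (+ 4 / 3) (2 * n ℕ.+ 3 * n)
        ≡⟨ poch-+ (+ 4 / 3) (2 * n) (3 * n) ⟩
      poch (+ 4 / 3) (2 * n) · poch (+ 4 / 3 + fromℕ (2 * n)) (3 * n)
        ≡⟨ cong (λ x → poch (+ 4 / 3) (2 * n) · poch x (3 * n)) (ℚ.+-comm (+ 4 / 3) (fromℕ (2 * n))) ⟩
      poch (+ 4 / 3) (2 * n) · poch d (3 * n) ∎

theorem7 : ∀ (n N : ℕ) → 3 * n ≤ N → ∑[ k ≤ N ] summand n (toℕ k) ≡ closedForm n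
theorem7 n N 3n≤N =
  trans (sum-cong-≗ {suc N} (λ k → summand≡term n (toℕ k))) (partial≡closedForm n 3n≤N)
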